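{- For all SCL-terms $t$ and $t'$ (possibly containing variables), $$\mathrm{EqMSCL}\vdash t=t'\quad\Longrightarrow\quad \mathrm{MSCL}\vdash t=t' .$$
   Context: Fix a countable set $A$ of atoms, treated as constants. $\curlywedge$ and $\curlyvee$ denote the binary connectives left-sequential (short-circuit) conjunction and disjunction. SCL-terms are terms built from variables, the constants $\mathsf T,\mathsf F$, atoms $a\in A$, the unary $\neg$ and the binary $\curlywedge,\curlyvee$. $\vdash$ is derivability in equational logic. $\mathrm{CP}_{mem}$ is the following set of axioms over the signature with constants $\mathsf T,\mathsf F$, atoms, and the ternary conditional $x\triangleleft y\triangleright z$ (read: if $y$ then $x$ else $z$): (CP1) $x\triangleleft\mathsf T\triangleright y=x$; (CP2) $x\triangleleft\mathsf F\triangleright y=y$; (CP3) $\mathsf T\triangleleft x\triangleright\mathsf F=x$; (CP4) $x\triangleleft(y\triangleleft z\triangleright u)\triangleright v=(x\triangleleft y\triangleright v)\triangleleft z\triangleright(x\triangleleft u\triangleright v)$; (CPmem) $x\triangleleft y\triangleright(z\triangleleft u\triangleright(v\triangleleft y\triangleright w))=x\triangleleft y\triangleright(z\triangleleft u\triangleright w)$. MSCL (memorizing short-circuit logic): for SCL-terms $t,t'$, $\mathrm{MSCL}\vdash t=t'$ means that $t=t'$ is derivable in equational logic from $\mathrm{CP}_{mem}$ together with the defining equations $\neg x=\mathsf F\triangleleft x\triangleright\mathsf T$, $x\curlywedge y=y\triangleleft x\triangleright\mathsf F$, and $x\curlyvee y=\neg(\neg x\curlywedge\neg y)$. EqMSCL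 is the following set of equations over SCL-terms: (SCL1) $\mathsf F=\neg\mathsf T$; (SCL2) $x\curlyvee y=\neg(\neg x\curlywedge\neg y)$; (SCL3) $\neg\neg x=x$; (SCL4) $\mathsf T\curlywedge x=x$; (SCL5) $x\curlywedge\mathsf T=x$; (SCL6) $\mathsf F\curlywedge x=\mathsf F$; (SCL7) $(x\curlywedge y)\curlywedge z=x\curlywedge(y\curlywedge z)$; (SCL8) $x\curlywedge\mathsf F=\neg x\curlywedge\mathsf F$; (MSCL1) $x\curlywedge(x\curlyvee y)=x$; (MSCL2) $x\curlywedge(y\curlyvee z)=(x\curlywedge y)\curlyvee(x\curlywedge z)$; (MSCL3) $(x\curlyvee y)\curlywedge(\neg x\curlyvee z)=(\neg x\curlyvee z)\curlywedge(x\curlyvee y)$; (MSCL4) $((x\curlywedge y)\curlyvee(\neg x\curlywedge z))\curlywedge u=(x\curlyvee(z\curlywedge u))\curlywedge(\neg x\curlyvee(y\curlywedge u))$. -}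

module Defs where

open import Data.Nat.Base using (ℕ)
open import Data.Vec.Base using (Vec; []; _∷_)
open import Data.Vec.Relation.Binary.Pointwise.Inductive using (Pointwise)
open import Function.Base using (id)
open import Level using (0ℓ)
open import Relation.Unary using (Pred; _∪_)

infix 4 _≐_
infix 3 _⊢_

-- A signature is a family Op : ℕ → Set, where Op n are the n-ary operation
-- symbols.  The variables are v₀, v₁, v₂, …, indexed by ℕ.

data Term (Op : ℕ → Set) : Set where
  var : ℕ → Term Op
  op  : ∀ {n} → Op n → Vec (Term Op) n → Term Op

module _ {Op : ℕ → Set} where

  substitute  : (ℕ → Term Op) → Term Op → Term Op
  substitutes : ∀ {n} → (ℕ → Term Op) → Vec (Term Op) n → Vec (Term Op) n

  substitute σ (var i)   = σ i
  substitute σ (op f ts) = op f (substitutes σ ts)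

  substitutes σ []       = []
  substitutes σ (t ∷ ts) = substitute σ t ∷ substitutes σ ts

module _ {Op Op′ : ℕ → Set} (φ : ∀ {n} → Op n → Op′ n) where

  translate  : Term Op → Term Op′
  translates : ∀ {n} → Vec (Term Op) n → Vec (Term Op′) n

  translate (var i)   = var i
  translate (op f ts) = op (φ f) (translates ts)

  translates []       = []
  translates (t ∷ ts) = translate t ∷ translates ts

record Equation (Op : ℕ → Set) : Set where
  constructor _≐_
  field
    lhs rhs : Term Op

data _⊢_ {Op : ℕ → Set} (E : Pred (Equation Op) 0ℓ) : Pred (Equation Op) 0ℓ where
  axiom        : ∀ {s t} → E (s ≐ t) → E ⊢ s ≐ t
  reflexivity  : ∀ {t} → E ⊢ t ≐ t
  symmetry     : ∀ {s t} → E ⊢ s ≐ t → E ⊢ t ≐ s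
  transitivity : ∀ {s t r} → E ⊢ s ≐ t → E ⊢ t ≐ r → E ⊢ s ≐ r
  congruence   : ∀ {n} (f : Op n) {ss ts : Vec (Term Op) n} →
                 Pointwise (λ s t → E ⊢ s ≐ t) ss ts → E ⊢ op f ss ≐ op f ts
  substitution : ∀ {s t} (σ : ℕ → Term Op) →
                 E ⊢ s ≐ t → E ⊢ substitute σ s ≐ substitute σ t

data SCLOp (A : Set) : ℕ → Set where
  true false : SCLOp A 0
  atom       : A → SCLOp A 0
  not        : SCLOp A 1
  and or     : SCLOp A 2

-- The joint signature of the conditional and the SCL connectives; T, F and the
-- atoms are shared.

data MSCLOp (A : Set) : ℕ → Set where
  scl  : ∀ {n} → SCLOp A n → MSCLOp A n
  cond : MSCLOp A 3

SCLTerm : Set → Set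
SCLTerm A = Term (SCLOp A)

MSCLTerm : Set → Set
MSCLTerm A = Term (MSCLOp A)

embed : {A : Set} → SCLTerm A → MSCLTerm A
embed = translate scl

module Connectives {A : Set} {Op : ℕ → Set} (φ : ∀ {n} → SCLOp A n → Op n) where

  infix 8 ¬_
  infix 7 _⋏_ _⋎_

  T F : Term Op
  T = op (φ true) []
  F = op (φ false) []

  ¬_ : Term Op → Term Op
  ¬ s = op (φ not) (s ∷ [])

  _⋏_ _⋎_ : Term Op → Term Op → Term Op
  s ⋏ t = op (φ and) (s ∷ t ∷ [])
  s ⋎ t = op (φ or) (s ∷ t ∷ [])

infix 6 _◁_▷_

_◁_▷_ : {A : Set} → MSCLTerm A → MSCLTerm A → MSCLTerm A → MSCLTerm A
s ◁ t ▷ r = op cond (s ∷ t ∷ r ∷ [])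

module Variables {Op : ℕ → Set} where

  x y z u v w : Term Op
  x = var 0
  y = var 1
  z = var 2
  u = var 3
  v = var 4
  w = var 5

open Variables

module _ (A : Set) where

  module _ where
    open Connectives {A} {SCLOp A} id

    data EqMSCL : Pred (Equation (SCLOp A)) 0ℓ where
      SCL1  : EqMSCL (F ≐ ¬ T)
      SCL2  : EqMSCL (x ⋎ y ≐ ¬ (¬ x ⋏ ¬ y))
      SCL3  : EqMSCL (¬ (¬ x) ≐ x)
      SCL4  : EqMSCL (T ⋏ x ≐ x)
      SCL5  : EqMSCL (x ⋏ T ≐ x)
      SCL6  : EqMSCL (F ⋏ x ≐ F)
      SCL7  : EqMSCL ((x ⋏ y) ⋏ z ≐ x ⋏ (y ⋏ z))
      SCL8  : EqMSCL (x ⋏ F ≐ ¬ x ⋏ F)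
      MSCL1 : EqMSCL (x ⋏ (x ⋎ y) ≐ x)
      MSCL2 : EqMSCL (x ⋏ (y ⋎ z) ≐ (x ⋏ y) ⋎ (x ⋏ z))
      MSCL3 : EqMSCL ((x ⋎ y) ⋏ (¬ x ⋎ z) ≐ (¬ x ⋎ z) ⋏ (x ⋎ y))
      MSCL4 : EqMSCL (((x ⋏ y) ⋎ (¬ x ⋏ z)) ⋏ u ≐
                      (x ⋎ (z ⋏ u)) ⋏ (¬ x ⋎ (y ⋏ u)))

  module _ where
    open Connectives {A} {MSCLOp A} scl

    data CPmem : Pred (Equation (MSCLOp A)) 0ℓ where
      CP1    : CPmem (x ◁ T ▷ y ≐ x)
      CP2    : CPmem (x ◁ F ▷ y ≐ y)
      CP3    : CPmem (T ◁ x ▷ F ≐ x)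
      CP4    : CPmem (x ◁ (y ◁ z ▷ u) ▷ v ≐ (x ◁ y ▷ v) ◁ z ▷ (x ◁ u ▷ v))
      CPmem′ : CPmem (x ◁ y ▷ (z ◁ u ▷ (v ◁ y ▷ w)) ≐ x ◁ y ▷ (z ◁ u ▷ w))

    data Definitions : Pred (Equation (MSCLOp A)) 0ℓ where
      ¬-def : Definitions (¬ x ≐ F ◁ x ▷ T)
      ⋏-def : Definitions (x ⋏ y ≐ y ◁ x ▷ F)
      ⋎-def : Definitions (x ⋎ y ≐ ¬ (¬ x ⋏ ¬ y))

  MSCL : Pred (Equation (MSCLOp A)) 0ℓ
  MSCL = CPmem ∪ Definitions

{-# OPTIONS --safe #-}
-- Every connective is a conditional, and a conditional on a conditional unfolds
-- by CP4, so both sides of each axiom of EqMSCL become nested conditionals.  A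
-- condition that recurs inside one of its own branches has a known outcome
-- there: CPmem says this for the else-branch, and negation exchanges the
-- branches.  Removing such repetitions makes the two sides coincide.
module Submission where

open import Defs
open import Data.List.Base using (List; []; _∷_)
open import Data.Nat.Base using (ℕ; zero; suc)
open import Data.Sum.Base using (inj₁; inj₂)
open import Data.Vec.Base using (Vec; []; _∷_)
open import Data.Vec.Relation.Binary.Pointwise.Inductive using (Pointwise; []; _∷_)
open import Function.Base using (_∘_)
open import Function.Bundles using (_↣_)
open import Level using (0ℓ)
open import Relation.Binary.Bundles using (Setoid)
open import Relation.Binary.PropositionalEquality using (_≡_; refl; cong; cong₂; subst₂; sym)
import Relation.Binary.Reasoning.Setoid as SetoidReasoning

module _ {Op Op′ : ℕ → Set} (φ : ∀ {n} → Op n → Op′ n) (σ : ℕ → Term Op) where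

  -- Needed for the substitution rule: a derivation instantiated before embedding must be matched
  -- with one instantiated after.
  translate-substitute : ∀ t → translate φ (substitute σ t) ≡
                               substitute (translate φ ∘ σ) (translate φ t)
  translates-substitutes : ∀ {n} (ts : Vec (Term Op) n) →
                           translates φ (substitutes σ ts) ≡
                           substitutes (translate φ ∘ σ) (translates φ ts)

  translate-substitute (var i)   = refl
  translate-substitute (op f ts) = cong (op (φ f)) (translates-substitutes ts)

  translates-substitutes []       = refl
  translates-substitutes (t ∷ ts) =
    cong₂ _∷_ (translate-substitute t) (translates-substitutes ts)

-- Instantiates an axiom by listing terms for `x`, `y`, `z`, `u`, `v`, `w` in this order; at these
-- concrete indices it computes, so instances need no conversion.
assign : ∀ {Op} → List (Term Op) → ℕ → Term Op
-- Past the list, variables are shifted down rather than fixed; harmless, as each list below covers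
-- all variables of its axiom.
assign []       i       = var i
assign (t ∷ ts) zero    = t
assign (t ∷ ts) (suc i) = assign ts i

module _ {A : Set} where

  open Connectives {A} {MSCLOp A} scl

  private
    variable
      a a′ b b′ c c′ d e p q : MSCLTerm A

  infix 4 _≈_

  _≈_ : MSCLTerm A → MSCLTerm A → Set
  s ≈ t = MSCL A ⊢ s ≐ t

  ≈-setoid : Setoid 0ℓ 0ℓ
  ≈-setoid = record
    { Carrier       = MSCLTerm A
    ; _≈_           = _≈_
    ; isEquivalence = record
      { refl = reflexivity ; sym = symmetry ; trans = transitivity }
    }

  open SetoidReasoning ≈-setoid

  cond-cong : a ≈ a′ → b ≈ b′ → c ≈ c′ → a ◁ b ▷ c ≈ a′ ◁ b′ ▷ c′
  cond-cong a≈ b≈ c≈ = congruence cond (a≈ ∷ b≈ ∷ c≈ ∷ [])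

  then-cong : a ≈ a′ → a ◁ b ▷ c ≈ a′ ◁ b ▷ c
  then-cong a≈ = cond-cong a≈ reflexivity reflexivity

  if-cong : b ≈ b′ → a ◁ b ▷ c ≈ a ◁ b′ ▷ c
  if-cong b≈ = cond-cong reflexivity b≈ reflexivity

  else-cong : c ≈ c′ → a ◁ b ▷ c ≈ a ◁ b ▷ c′
  else-cong c≈ = cond-cong reflexivity reflexivity c≈

  branches-cong : a ≈ a′ → c ≈ c′ → a ◁ b ▷ c ≈ a′ ◁ b ▷ c′
  branches-cong a≈ c≈ = cond-cong a≈ reflexivity c≈

  cond-T : a ◁ T ▷ b ≈ a
  cond-T {a} {b} = substitution (assign (a ∷ b ∷ [])) (axiom (inj₁ CP1))

  cond-F : a ◁ F ▷ b ≈ b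
  cond-F {a} {b} = substitution (assign (a ∷ b ∷ [])) (axiom (inj₁ CP2))

  T-cond-F : T ◁ a ▷ F ≈ a
  T-cond-F {a} = substitution (assign (a ∷ [])) (axiom (inj₁ CP3))

  cond-cond : a ◁ (b ◁ c ▷ d) ▷ e ≈ (a ◁ b ▷ e) ◁ c ▷ (a ◁ d ▷ e)
  cond-cond {a} {b} {c} {d} {e} =
    substitution (assign (a ∷ b ∷ c ∷ d ∷ e ∷ [])) (axiom (inj₁ CP4))

  ¬-cond : ¬ a ≈ F ◁ a ▷ T
  ¬-cond {a} = substitution (assign (a ∷ [])) (axiom (inj₂ ¬-def))

  ⋏-cond : a ⋏ b ≈ b ◁ a ▷ F
  ⋏-cond {a} {b} = substitution (assign (a ∷ b ∷ [])) (axiom (inj₂ ⋏-def))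

  ⋎-deMorgan : a ⋎ b ≈ ¬ (¬ a ⋏ ¬ b)
  ⋎-deMorgan {a} {b} = substitution (assign (a ∷ b ∷ [])) (axiom (inj₂ ⋎-def))

  cond-¬ : a ◁ ¬ p ▷ b ≈ b ◁ p ▷ a
  cond-¬ {a} {p} {b} = begin
    a ◁ ¬ p ▷ b                    ≈⟨ if-cong ¬-cond ⟩
    a ◁ (F ◁ p ▷ T) ▷ b            ≈⟨ cond-cond ⟩
    (a ◁ F ▷ b) ◁ p ▷ (a ◁ T ▷ b)  ≈⟨ branches-cong cond-F cond-T ⟩
    b ◁ p ▷ a                      ∎

  cond-⋏ : a ◁ (p ⋏ q) ▷ b ≈ (a ◁ q ▷ b) ◁ p ▷ b
  cond-⋏ {a} {p} {q} {b} = begin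
    a ◁ (p ⋏ q) ▷ b                ≈⟨ if-cong ⋏-cond ⟩
    a ◁ (q ◁ p ▷ F) ▷ b            ≈⟨ cond-cond ⟩
    (a ◁ q ▷ b) ◁ p ▷ (a ◁ F ▷ b)  ≈⟨ else-cong cond-F ⟩
    (a ◁ q ▷ b) ◁ p ▷ b            ∎

  cond-⋎ : a ◁ (p ⋎ q) ▷ b ≈ a ◁ p ▷ (a ◁ q ▷ b)
  cond-⋎ {a} {p} {q} {b} = begin
    a ◁ (p ⋎ q) ▷ b          ≈⟨ if-cong ⋎-deMorgan ⟩
    a ◁ ¬ (¬ p ⋏ ¬ q) ▷ b    ≈⟨ cond-¬ ⟩
    b ◁ (¬ p ⋏ ¬ q) ▷ a      ≈⟨ cond-⋏ ⟩
    (b ◁ ¬ q ▷ a) ◁ ¬ p ▷ a  ≈⟨ cond-¬ ⟩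
    a ◁ p ▷ (b ◁ ¬ q ▷ a)    ≈⟨ else-cong cond-¬ ⟩
    a ◁ p ▷ (a ◁ q ▷ b)      ∎

  ⋎-cond : a ⋎ b ≈ T ◁ a ▷ b
  ⋎-cond {a} {b} = begin
    -- CP3 read backwards moves the disjunction into condition position, where `cond-⋎` applies.
    a ⋎ b                ≈⟨ T-cond-F ⟨
    T ◁ (a ⋎ b) ▷ F      ≈⟨ cond-⋎ ⟩
    T ◁ a ▷ (T ◁ b ▷ F)  ≈⟨ else-cong T-cond-F ⟩
    T ◁ a ▷ b            ∎

  ¬-⋏-cond : ¬ a ⋏ b ≈ F ◁ a ▷ b
  ¬-⋏-cond = transitivity ⋏-cond cond-¬

  ¬-⋎-cond : ¬ a ⋎ b ≈ b ◁ a ▷ T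
  ¬-⋎-cond = transitivity ⋎-cond cond-¬

  ¬-involutive : ¬ (¬ a) ≈ a
  ¬-involutive {a} = begin
    ¬ (¬ a)      ≈⟨ ¬-cond ⟩
    F ◁ ¬ a ▷ T  ≈⟨ cond-¬ ⟩
    T ◁ a ▷ F    ≈⟨ T-cond-F ⟩
    a            ∎

  -- CPmem itself. In this name and the next three, the first word is the branch of the outer `p`,
  -- the second the branch of `q` in which `p` recurs. Negating `p` or `q` yields the other cases.
  mem-else-else : a ◁ p ▷ (b ◁ q ▷ (c ◁ p ▷ d)) ≈ a ◁ p ▷ (b ◁ q ▷ d)
  mem-else-else {a} {p} {b} {q} {c} {d} =
    substitution (assign (a ∷ p ∷ b ∷ q ∷ c ∷ d ∷ [])) (axiom (inj₁ CPmem′))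

  mem-else-then : a ◁ p ▷ ((c ◁ p ▷ d) ◁ q ▷ b) ≈ a ◁ p ▷ (d ◁ q ▷ b)
  mem-else-then {a} {p} {c} {d} {q} {b} = begin
    a ◁ p ▷ ((c ◁ p ▷ d) ◁ q ▷ b)    ≈⟨ else-cong cond-¬ ⟨
    a ◁ p ▷ (b ◁ ¬ q ▷ (c ◁ p ▷ d))  ≈⟨ mem-else-else ⟩
    a ◁ p ▷ (b ◁ ¬ q ▷ d)            ≈⟨ else-cong cond-¬ ⟩
    a ◁ p ▷ (d ◁ q ▷ b)              ∎

  mem-then-else : (b ◁ q ▷ (c ◁ p ▷ d)) ◁ p ▷ a ≈ (b ◁ q ▷ c) ◁ p ▷ a
  mem-then-else {b} {q} {c} {p} {d} {a} = begin
    (b ◁ q ▷ (c ◁ p ▷ d)) ◁ p ▷ a      ≈⟨ cond-¬ ⟨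
    -- CPmem needs the same condition in both places, so the inner `p` is negated too; this is why
    -- `c` survives instead of `d`.
    a ◁ ¬ p ▷ (b ◁ q ▷ (c ◁ p ▷ d))    ≈⟨ else-cong (else-cong cond-¬) ⟨
    a ◁ ¬ p ▷ (b ◁ q ▷ (d ◁ ¬ p ▷ c))  ≈⟨ mem-else-else ⟩
    a ◁ ¬ p ▷ (b ◁ q ▷ c)              ≈⟨ cond-¬ ⟩
    (b ◁ q ▷ c) ◁ p ▷ a                ∎

  mem-then-then : ((c ◁ p ▷ d) ◁ q ▷ b) ◁ p ▷ a ≈ (c ◁ q ▷ b) ◁ p ▷ a
  mem-then-then {c} {p} {d} {q} {b} {a} = begin
    ((c ◁ p ▷ d) ◁ q ▷ b) ◁ p ▷ a    ≈⟨ then-cong cond-¬ ⟨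
    (b ◁ ¬ q ▷ (c ◁ p ▷ d)) ◁ p ▷ a  ≈⟨ mem-then-else ⟩
    (b ◁ ¬ q ▷ c) ◁ p ▷ a            ≈⟨ then-cong cond-¬ ⟩
    (c ◁ q ▷ b) ◁ p ▷ a              ∎

  contract-else : a ◁ p ▷ (b ◁ p ▷ c) ≈ a ◁ p ▷ c
  contract-else {a} {p} {b} {c} = begin
    -- CPmem requires an intermediate condition; `F` supplies a vacuous one, and the `T` beside it
    -- is arbitrary.
    a ◁ p ▷ (b ◁ p ▷ c)            ≈⟨ else-cong cond-F ⟨
    a ◁ p ▷ (T ◁ F ▷ (b ◁ p ▷ c))  ≈⟨ mem-else-else ⟩
    a ◁ p ▷ (T ◁ F ▷ c)            ≈⟨ else-cong cond-F ⟩
    a ◁ p ▷ c                      ∎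

  contract-then : (a ◁ p ▷ b) ◁ p ▷ c ≈ a ◁ p ▷ c
  contract-then {a} {p} {b} {c} = begin
    (a ◁ p ▷ b) ◁ p ▷ c            ≈⟨ then-cong cond-F ⟨
    (T ◁ F ▷ (a ◁ p ▷ b)) ◁ p ▷ c  ≈⟨ mem-then-else ⟩
    (T ◁ F ▷ a) ◁ p ▷ c            ≈⟨ then-cong cond-F ⟩
    a ◁ p ▷ c                      ∎

  ⋏-assoc : (a ⋏ b) ⋏ c ≈ a ⋏ (b ⋏ c)
  ⋏-assoc {a} {b} {c} = begin
    (a ⋏ b) ⋏ c          ≈⟨ ⋏-cond ⟩
    c ◁ (a ⋏ b) ▷ F      ≈⟨ cond-⋏ ⟩
    (c ◁ b ▷ F) ◁ a ▷ F  ≈⟨ then-cong ⋏-cond ⟨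
    (b ⋏ c) ◁ a ▷ F      ≈⟨ ⋏-cond ⟨
    a ⋏ (b ⋏ c)          ∎

  -- Both sides are `F ◁ a ▷ F`, whose equal branches negation exchanges without effect.
  ⋏-F : a ⋏ F ≈ ¬ a ⋏ F
  ⋏-F = transitivity ⋏-cond (symmetry ¬-⋏-cond)

  ⋏-absorbs-⋎ : a ⋏ (a ⋎ b) ≈ a
  ⋏-absorbs-⋎ {a} {b} = begin
    a ⋏ (a ⋎ b)          ≈⟨ ⋏-cond ⟩
    (a ⋎ b) ◁ a ▷ F      ≈⟨ then-cong ⋎-cond ⟩
    (T ◁ a ▷ b) ◁ a ▷ F  ≈⟨ contract-then ⟩
    T ◁ a ▷ F            ≈⟨ T-cond-F ⟩
    a                    ∎

  ⋏-distribˡ-⋎ : a ⋏ (b ⋎ c) ≈ (a ⋏ b) ⋎ (a ⋏ c)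
  ⋏-distribˡ-⋎ {a} {b} {c} = begin
    a ⋏ (b ⋎ c)                              ≈⟨ ⋏-cond ⟩
    (b ⋎ c) ◁ a ▷ F                          ≈⟨ then-cong ⋎-cond ⟩
    -- The target tests `a` again, so the memory laws run backwards here: first `F`, then `c`, is
    -- expanded to `c ◁ a ▷ F`.
    (T ◁ b ▷ c) ◁ a ▷ F                      ≈⟨ contract-else ⟨
    (T ◁ b ▷ c) ◁ a ▷ (c ◁ a ▷ F)            ≈⟨ mem-then-else ⟨
    (T ◁ b ▷ (c ◁ a ▷ F)) ◁ a ▷ (c ◁ a ▷ F)  ≈⟨ cond-⋏ ⟨
    T ◁ (a ⋏ b) ▷ (c ◁ a ▷ F)                ≈⟨ else-cong ⋏-cond ⟨
    T ◁ (a ⋏ b) ▷ (a ⋏ c)                    ≈⟨ ⋎-cond ⟨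
    (a ⋏ b) ⋎ (a ⋏ c)                        ∎

  cond-as-⋏-of-⋎ : (p ⋎ b) ⋏ (¬ p ⋎ a) ≈ a ◁ p ▷ b
  cond-as-⋏-of-⋎ {p} {b} {a} = begin
    (p ⋎ b) ⋏ (¬ p ⋎ a)                      ≈⟨ ⋏-cond ⟩
    (¬ p ⋎ a) ◁ (p ⋎ b) ▷ F                  ≈⟨ then-cong ¬-⋎-cond ⟩
    (a ◁ p ▷ T) ◁ (p ⋎ b) ▷ F                ≈⟨ cond-⋎ ⟩
    (a ◁ p ▷ T) ◁ p ▷ ((a ◁ p ▷ T) ◁ b ▷ F)  ≈⟨ contract-then ⟩
    a ◁ p ▷ ((a ◁ p ▷ T) ◁ b ▷ F)            ≈⟨ mem-else-then ⟩
    a ◁ p ▷ (T ◁ b ▷ F)                      ≈⟨ else-cong T-cond-F ⟩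
    a ◁ p ▷ b                                ∎

  cond-as-⋏-of-⋎′ : (¬ p ⋎ a) ⋏ (p ⋎ b) ≈ a ◁ p ▷ b
  cond-as-⋏-of-⋎′ {p} {a} {b} = begin
    (¬ p ⋎ a) ⋏ (p ⋎ b)                        ≈⟨ ⋏-cond ⟩
    (p ⋎ b) ◁ (¬ p ⋎ a) ▷ F                    ≈⟨ then-cong ⋎-cond ⟩
    (T ◁ p ▷ b) ◁ (¬ p ⋎ a) ▷ F                ≈⟨ cond-⋎ ⟩
    (T ◁ p ▷ b) ◁ ¬ p ▷ ((T ◁ p ▷ b) ◁ a ▷ F)  ≈⟨ cond-¬ ⟩
    ((T ◁ p ▷ b) ◁ a ▷ F) ◁ p ▷ (T ◁ p ▷ b)    ≈⟨ mem-then-then ⟩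
    (T ◁ a ▷ F) ◁ p ▷ (T ◁ p ▷ b)              ≈⟨ contract-else ⟩
    (T ◁ a ▷ F) ◁ p ▷ b                        ≈⟨ then-cong T-cond-F ⟩
    a ◁ p ▷ b                                  ∎

  cond-as-⋎-of-⋏ : (p ⋏ a) ⋎ (¬ p ⋏ b) ≈ a ◁ p ▷ b
  cond-as-⋎-of-⋏ {p} {a} {b} = begin
    (p ⋏ a) ⋎ (¬ p ⋏ b)                      ≈⟨ ⋎-cond ⟩
    T ◁ (p ⋏ a) ▷ (¬ p ⋏ b)                  ≈⟨ else-cong ¬-⋏-cond ⟩
    -- Unfolding the conjunction copies `F ◁ p ▷ b` into both branches of `p`, where memory reduces
    -- it to `F` and to `b`.
    T ◁ (p ⋏ a) ▷ (F ◁ p ▷ b)                ≈⟨ cond-⋏ ⟩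
    (T ◁ a ▷ (F ◁ p ▷ b)) ◁ p ▷ (F ◁ p ▷ b)  ≈⟨ mem-then-else ⟩
    (T ◁ a ▷ F) ◁ p ▷ (F ◁ p ▷ b)            ≈⟨ contract-else ⟩
    (T ◁ a ▷ F) ◁ p ▷ b                      ≈⟨ then-cong T-cond-F ⟩
    a ◁ p ▷ b                                ∎

  -- Once both normal forms are read as conditionals on `p`, this is CP4 with `F` as the outer
  -- else-branch.
  ⋏-distribʳ-cond : ((p ⋏ a) ⋎ (¬ p ⋏ b)) ⋏ c ≈ (p ⋎ (b ⋏ c)) ⋏ (¬ p ⋎ (a ⋏ c))
  ⋏-distribʳ-cond {p} {a} {b} {c} = begin
    ((p ⋏ a) ⋎ (¬ p ⋏ b)) ⋏ c        ≈⟨ ⋏-cond ⟩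
    c ◁ ((p ⋏ a) ⋎ (¬ p ⋏ b)) ▷ F    ≈⟨ if-cong cond-as-⋎-of-⋏ ⟩
    c ◁ (a ◁ p ▷ b) ▷ F              ≈⟨ cond-cond ⟩
    (c ◁ a ▷ F) ◁ p ▷ (c ◁ b ▷ F)    ≈⟨ branches-cong ⋏-cond ⋏-cond ⟨
    (a ⋏ c) ◁ p ▷ (b ⋏ c)            ≈⟨ cond-as-⋏-of-⋎ ⟨
    (p ⋎ (b ⋏ c)) ⋏ (¬ p ⋎ (a ⋏ c))  ∎

  embed-axiom : ∀ {s t} → EqMSCL A (s ≐ t) → embed s ≈ embed t
  embed-axiom SCL1  = symmetry (transitivity ¬-cond cond-T)
  embed-axiom SCL2  = ⋎-deMorgan
  embed-axiom SCL3  = ¬-involutive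
  embed-axiom SCL4  = transitivity ⋏-cond cond-T
  embed-axiom SCL5  = transitivity ⋏-cond T-cond-F
  embed-axiom SCL6  = transitivity ⋏-cond cond-F
  embed-axiom SCL7  = ⋏-assoc
  embed-axiom SCL8  = ⋏-F
  embed-axiom MSCL1 = ⋏-absorbs-⋎
  embed-axiom MSCL2 = ⋏-distribˡ-⋎
  embed-axiom MSCL3 = transitivity cond-as-⋏-of-⋎ (symmetry cond-as-⋏-of-⋎′)
  embed-axiom MSCL4 = ⋏-distribʳ-cond

  -- Induction on the derivation: every rule is matched by the same rule of the larger signature,
  -- and axioms by the derivations above.
  embed-derivation : ∀ {s t} → EqMSCL A ⊢ s ≐ t → embed s ≈ embed t
  embed-derivations : ∀ {n} {ss ts : Vec (SCLTerm A) n} →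
                      Pointwise (λ s t → EqMSCL A ⊢ s ≐ t) ss ts →
                      Pointwise _≈_ (translates scl ss) (translates scl ts)

  embed-derivation (axiom ax) = embed-axiom ax
  embed-derivation reflexivity = reflexivity
  embed-derivation (symmetry s≈t) = symmetry (embed-derivation s≈t)
  embed-derivation (transitivity s≈t t≈r) =
    transitivity (embed-derivation s≈t) (embed-derivation t≈r)
  embed-derivation (congruence f ss≈ts) = congruence (scl f) (embed-derivations ss≈ts)
  embed-derivation (substitution {s} {t} σ s≈t) =
    subst₂ _≈_ (sym (translate-substitute scl σ s)) (sym (translate-substitute scl σ t))
      (substitution (embed ∘ σ) (embed-derivation s≈t))

  embed-derivations []            = []
  embed-derivations (s≈t ∷ ss≈ts) = embed-derivation s≈t ∷ embed-derivations ss≈ts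

proposition2 : (A : Set) → A ↣ ℕ → (t t′ : SCLTerm A) →
    EqMSCL A ⊢ t ≐ t′ → MSCL A ⊢ embed t ≐ embed t′
proposition2 A _ t t′ = embed-derivation
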